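{- Let $r$ and $n$ be integers such that $1 \le r \le n$ and $n \equiv 0 \pmod r$. If $F_1$ and $F_2$ are graphs on a common set of $n$ vertices, each of which consists of the vertex-disjoint union of $n/r$ copies of $K_r$, then $\gamma_{\rm sd}(F_1,F_2) = n/r$.
   Context: All graphs are finite and simple. Given graphs $F_1, F_2$ (called factors; not necessarily edge-disjoint) with common vertex set $V$, a set $S \subseteq V$ is a simultaneous dominating set if for each $i \in \{1,2\}$ every vertex not in $S$ is adjacent in $F_i$ to some vertex of $S$. The simultaneous domination number $\gamma_{\rm sd}(F_1,F_2)$ is the minimum cardinality of a simultaneous dominating set. -}

module Defs where

open import Data.Fin.Base using (Fin)
open import Data.Fin.Properties as Fin using (all?; any?)
open import Data.Fin.Subset using (Subset; ⊤; _∈_; _∉_; ∣_∣)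
open import Data.Fin.Subset.Properties using (_∈?_; ∈⊤; anySubset?)
open import Data.Nat.Base using (ℕ; _≤_; _<_)
open import Data.Nat.Induction using (<-wellFounded)
open import Data.Nat.Properties using (_<?_; ≮⇒≥)
open import Data.Product.Base using (_×_; _,_; ∃; ∃-syntax; proj₁; proj₂)
open import Function.Bundles using (_↔_; _⇔_; Inverse)
open import Induction.WellFounded using (Acc; acc)
open import Level using (0ℓ)
open import Relation.Binary.Core using (Rel)
open import Relation.Binary.Definitions using (Decidable; Irreflexive; Symmetric)
open import Relation.Binary.PropositionalEquality using (_≡_; _≢_; refl; sym)
open import Relation.Nullary using (yes; no; ¬?; contradiction)
open import Relation.Nullary.Decidable using (_×-dec_; _→-dec_)
open import Relation.Unary as U using (Pred)

-- Decidable adjacency is part of being a finite graph, as γsd below needs it to exist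
-- constructively.
record Graph (V : Set) : Set₁ where
  field
    Adj        : Rel V 0ℓ
    adj-sym    : Symmetric Adj
    adj-irrefl : Irreflexive _≡_ Adj
    adj?       : Decidable Adj

open Graph public

K : ∀ r → Graph (Fin r)
K r = record
  { Adj        = _≢_
  ; adj-sym    = λ u≢v v≡u → u≢v (sym v≡u)
  ; adj-irrefl = λ u≡v u≢v → u≢v u≡v
  ; adj?       = λ u v → ¬? (u Fin.≟ v)
  }

infixr 7 _copiesOf_

-- The vertex (i , v) is the vertex v of the i-th copy.
_copiesOf_ : ∀ {V} m → Graph V → Graph (Fin m × V)
m copiesOf G = record
  { Adj        = λ (i , u) (j , v) → i ≡ j × Adj G u v
  ; adj-sym    = λ (i≡j , uv) → sym i≡j , adj-sym G uv
  ; adj-irrefl = λ { refl (_ , uu) → adj-irrefl G refl uu }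
  ; adj?       = λ (i , u) (j , v) → (i Fin.≟ j) ×-dec adj? G u v
  }

infix 4 _≅_

record _≅_ {V W : Set} (G : Graph V) (H : Graph W) : Set where
  field
    bijection : V ↔ W

  open Inverse bijection public using (to; from)

  field
    preserves : ∀ u v → Adj G u v ⇔ Adj H (to u) (to v)

module _ {n : ℕ} where

  Dominating : Graph (Fin n) → Pred (Subset n) 0ℓ
  Dominating F S = ∀ v → v ∉ S → ∃[ u ] (u ∈ S × Adj F v u)

  SimultaneousDominating : Graph (Fin n) → Graph (Fin n) → Pred (Subset n) 0ℓ
  SimultaneousDominating F₁ F₂ S = Dominating F₁ S × Dominating F₂ S

  IsMinimumCardinality : Pred (Subset n) 0ℓ → ℕ → Set
  IsMinimumCardinality P k =
    (∃[ S ] (P S × ∣ S ∣ ≡ k)) × (∀ S → P S → k ≤ ∣ S ∣)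

  minimumCardinality : ∀ {P} → U.Decidable P → ∃ P → ∃ (IsMinimumCardinality P)
  minimumCardinality {P} P? (S , pS) = descend S pS (<-wellFounded ∣ S ∣)
    where
    descend : ∀ S → P S → Acc _<_ ∣ S ∣ → ∃ (IsMinimumCardinality P)
    descend S pS (acc rec) with anySubset? (λ T → P? T ×-dec (∣ T ∣ <? ∣ S ∣))
    ... | yes (T , pT , T<S) = descend T pT (rec T<S)
    ... | no  none = ∣ S ∣ , (S , pS , refl) ,
                     λ T pT → ≮⇒≥ λ T<S → none (T , pT , T<S)

  dominating? : ∀ F → U.Decidable (Dominating F)
  dominating? F S =
    all? λ v → ¬? (v ∈? S) →-dec any? λ u → (u ∈? S) ×-dec adj? F v u

  module _ (F₁ F₂ : Graph (Fin n)) where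

    simultaneousDominating? : U.Decidable (SimultaneousDominating F₁ F₂)
    simultaneousDominating? S = dominating? F₁ S ×-dec dominating? F₂ S

    ⊤-simultaneousDominating : SimultaneousDominating F₁ F₂ ⊤
    ⊤-simultaneousDominating =
      (λ v v∉⊤ → contradiction ∈⊤ v∉⊤) , (λ v v∉⊤ → contradiction ∈⊤ v∉⊤)

    γsd-exists : ∃ (IsMinimumCardinality (SimultaneousDominating F₁ F₂))
    γsd-exists =
      minimumCardinality simultaneousDominating? (⊤ , ⊤-simultaneousDominating)

    γsd : ℕ
    γsd = proj₁ γsd-exists

    γsd-isMinimum : IsMinimumCardinality (SimultaneousDominating F₁ F₂) γsd
    γsd-isMinimum = proj₂ γsd-exists

{-# OPTIONS --safe #-}
-- Contracting the cliques of F₁ and of F₂ turns the n vertices into the edges of an r-regular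
-- bipartite multigraph with n / r nodes on either side, and the simultaneous dominating sets
-- are exactly the edge covers.  Each F₁-clique needs its own element, so n / r is a lower bound.
-- For the upper bound, regularity gives Hall's condition for the full edge set, and an edge set
-- minimal subject to Hall's condition is a perfect matching (Rado): if two of its edges e, f
-- shared an end on the left, sets I and J violating the condition for E - e and E - f would
-- contradict the submodularity of the neighbourhood cardinality.
module Submission where

open import Defs
open import Data.Bool.Base using (true)
open import Data.Fin.Base using (Fin; zero; suc; combine; fromℕ<; inject≤; remQuot)
open import Data.Fin.Properties as Fin
  using (any?; suc-injective; injective⇒≤; combine-injective; combine-remQuot)
open import Data.Fin.Subset
  using (Subset; inside; outside; _∈_; _∉_; _⊆_; ∣_∣; _∪_; _∩_; _-_; ⁅_⁆; ⊤)
open import Data.Fin.Subset.Properties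
  using ( _∈?_; ∈⊤; anySubset?; p⊆q⇒∣p∣≤∣q∣; x∈p∩q⁺; x∈p∩q⁻; x∈p∪q⁺; x∈p∪q⁻; p─q⊆p
        ; x∈p∧x≢y⇒x∈p-y; x∈p⇒∣p-x∣<∣p∣; ∣⁅x⁆∣≡1; x∈⁅x⁆; x∈⁅y⁆⇒x≡y; ∣⊤∣≡n; ∣p∣≡n⇒p≡⊤; ∣p∣≤n)
open import Data.Nat.Base
  using (ℕ; NonZero; suc; _+_; _*_; _≤_; _<_; _/_; _%_; s≤s; ≢-nonZero⁻¹)
open import Data.Nat.Properties
  using ( _<?_; n≢0⇒n>0; m≤m+n; ≤-trans; ≤-antisym; ≤-reflexive; <⇒≱; ≮⇒≥; +-suc; +-mono-≤
        ; *-cancelʳ-≤; module ≤-Reasoning)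
open import Data.Product.Base using (_×_; _,_; ∃; ∃-syntax; proj₁; proj₂)
open import Data.Product.Properties using (,-injectiveˡ; ,-injectiveʳ)
open import Data.Sum.Base using (_⊎_; inj₁; inj₂)
open import Data.Vec.Base using (_∷_; []; here; there; tabulate)
open import Data.Vec.Properties using ([]=⇒lookup; lookup⇒[]=; lookup∘tabulate)
open import Function.Base using (_∘_)
open import Function.Bundles using (_↔_; Inverse; Injection; Equivalence)
open import Function.Properties.Inverse using (↔-sym; ↔⇒↣)
open import Level using (0ℓ)
open import Relation.Binary.PropositionalEquality
  using (_≡_; _≢_; refl; sym; trans; cong; cong₂; subst)
open import Relation.Nullary using (¬_; Dec; does; yes; no; ¬?; contradiction)
open import Relation.Nullary.Decidable using (_×-dec_; dec-true; decidable-stable)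
open import Relation.Unary as U using (Pred)

private
  variable
    k m n r : ℕ
    x y : Fin n
    p q : Subset n

-- Cardinality and enumeration of finite subsets.

∣p∪q∣+∣p∩q∣≡∣p∣+∣q∣ : ∀ (p q : Subset n) → ∣ p ∪ q ∣ + ∣ p ∩ q ∣ ≡ ∣ p ∣ + ∣ q ∣
∣p∪q∣+∣p∩q∣≡∣p∣+∣q∣ []            []            = refl
∣p∪q∣+∣p∩q∣≡∣p∣+∣q∣ (outside ∷ p) (outside ∷ q) = ∣p∪q∣+∣p∩q∣≡∣p∣+∣q∣ p q
∣p∪q∣+∣p∩q∣≡∣p∣+∣q∣ (inside  ∷ p) (outside ∷ q) = cong suc (∣p∪q∣+∣p∩q∣≡∣p∣+∣q∣ p q)
∣p∪q∣+∣p∩q∣≡∣p∣+∣q∣ (outside ∷ p) (inside  ∷ q) =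
  trans (cong suc (∣p∪q∣+∣p∩q∣≡∣p∣+∣q∣ p q)) (sym (+-suc ∣ p ∣ ∣ q ∣))
∣p∪q∣+∣p∩q∣≡∣p∣+∣q∣ (inside  ∷ p) (inside  ∷ q) = cong suc
  (trans (+-suc ∣ p ∪ q ∣ ∣ p ∩ q ∣)
    (trans (cong suc (∣p∪q∣+∣p∩q∣≡∣p∣+∣q∣ p q)) (sym (+-suc ∣ p ∣ ∣ q ∣))))

x∉p-x : ∀ (p : Subset n) x → x ∉ p - x
x∉p-x (_ ∷ p) (suc x) (there x∈p-x) = x∉p-x p x x∈p-x

∣p∣≤1+∣p-x∣ : ∀ (p : Subset n) x → ∣ p ∣ ≤ suc ∣ p - x ∣
∣p∣≤1+∣p-x∣ p x = begin
  ∣ p ∣                                            ≤⟨ p⊆q⇒∣p∣≤∣q∣ p⊆ ⟩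
  ∣ ⁅ x ⁆ ∪ (p - x) ∣                              ≤⟨ m≤m+n _ _ ⟩
  ∣ ⁅ x ⁆ ∪ (p - x) ∣ + ∣ ⁅ x ⁆ ∩ (p - x) ∣        ≡⟨ ∣p∪q∣+∣p∩q∣≡∣p∣+∣q∣ ⁅ x ⁆ (p - x) ⟩
  ∣ ⁅ x ⁆ ∣ + ∣ p - x ∣                            ≡⟨ cong (_+ ∣ p - x ∣) (∣⁅x⁆∣≡1 x) ⟩
  suc ∣ p - x ∣                                    ∎
  where
  open ≤-Reasoning
  p⊆ : p ⊆ ⁅ x ⁆ ∪ (p - x)
  p⊆ {y} y∈p with y Fin.≟ x
  ... | yes refl = x∈p∪q⁺ (inj₁ (x∈⁅x⁆ x))
  ... | no  y≢x  = x∈p∪q⁺ (inj₂ (x∈p∧x≢y⇒x∈p-y y∈p y≢x))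

-- With `element` this turns comparisons of cardinalities into injections between `Fin` types.
rank : x ∈ p → Fin ∣ p ∣
rank {p = inside  ∷ p} here        = zero
rank {p = inside  ∷ p} (there x∈p) = suc (rank x∈p)
rank {p = outside ∷ p} (there x∈p) = rank x∈p

rank-injective : (x∈p : x ∈ p) (y∈p : y ∈ p) → rank x∈p ≡ rank y∈p → x ≡ y
rank-injective {p = inside  ∷ p} here        here        _  = refl
rank-injective {p = inside  ∷ p} (there x∈p) (there y∈p) eq =
  cong suc (rank-injective x∈p y∈p (suc-injective eq))
rank-injective {p = outside ∷ p} (there x∈p) (there y∈p) eq =
  cong suc (rank-injective x∈p y∈p eq)

element : ∀ (p : Subset n) → Fin ∣ p ∣ → Fin n
element (inside  ∷ p) zero    = zero
element (inside  ∷ p) (suc i) = suc (element p i)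
element (outside ∷ p) i       = suc (element p i)

element∈ : ∀ (p : Subset n) i → element p i ∈ p
element∈ (inside  ∷ p) zero    = here
element∈ (inside  ∷ p) (suc i) = there (element∈ p i)
element∈ (outside ∷ p) i       = there (element∈ p i)

element-injective : ∀ (p : Subset n) {i j} → element p i ≡ element p j → i ≡ j
element-injective (inside  ∷ p) {zero}  {zero}  _  = refl
element-injective (inside  ∷ p) {suc i} {suc j} eq =
  cong suc (element-injective p (suc-injective eq))
element-injective (outside ∷ p)                 eq = element-injective p (suc-injective eq)

comprehension : {P : Pred (Fin n) 0ℓ} → U.Decidable P → Subset n
comprehension P? = tabulate (does ∘ P?)

∈-comprehension⁺ : {P : Pred (Fin n) 0ℓ} (P? : U.Decidable P) → P x → x ∈ comprehension P?
∈-comprehension⁺ {x = x} P? Px =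
  lookup⇒[]= x _ (trans (lookup∘tabulate (does ∘ P?) x) (dec-true (P? x) Px))

∈-comprehension⁻ : {P : Pred (Fin n) 0ℓ} (P? : U.Decidable P) → x ∈ comprehension P? → P x
∈-comprehension⁻ {x = x} P? x∈ =
  dec-true⁻ (P? x) (trans (sym (lookup∘tabulate (does ∘ P?) x)) ([]=⇒lookup x∈))
  where
  dec-true⁻ : {A : Set} (A? : Dec A) → does A? ≡ true → A
  dec-true⁻ (yes a) _ = a

-- Hall's condition in bipartite multigraphs.

-- A bipartite multigraph is given by its edge set Fin n and the left and right ends of an edge.
module Bipartite (left : Fin n → Fin k) (right : Fin n → Fin m) where

  private
    neighbour? : ∀ E I → U.Decidable (λ j → ∃[ e ] (e ∈ E × left e ∈ I × right e ≡ j))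
    neighbour? E I j = any? λ e → (e ∈? E) ×-dec (left e ∈? I) ×-dec (right e Fin.≟ j)

  opaque
    neighbours : Subset n → Subset k → Subset m
    neighbours E I = comprehension (neighbour? E I)

    ∈-neighbours⁺ : ∀ {E I e} → e ∈ E → left e ∈ I → right e ∈ neighbours E I
    ∈-neighbours⁺ {E} {I} e∈E e∈I = ∈-comprehension⁺ (neighbour? E I) (_ , e∈E , e∈I , refl)

    ∈-neighbours⁻ : ∀ {E I j} → j ∈ neighbours E I →
                    ∃[ e ] (e ∈ E × left e ∈ I × right e ≡ j)
    ∈-neighbours⁻ {E} {I} = ∈-comprehension⁻ (neighbour? E I)

  neighbours⊆ : ∀ {E I q} → (∀ {e} → e ∈ E → left e ∈ I → right e ∈ q) → neighbours E I ⊆ q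
  neighbours⊆ f j∈N with ∈-neighbours⁻ j∈N
  ... | e , e∈E , e∈I , refl = f e∈E e∈I

  Deficient : Subset n → Subset k → Set
  Deficient E I = ∣ neighbours E I ∣ < ∣ I ∣

  -- Phrased negatively so that, inside a proof of a negation, its failure hands over a deficient
  -- set.
  Hall : Subset n → Set
  Hall E = ¬ ∃ (Deficient E)

  deficient? : ∀ E → Dec (∃ (Deficient E))
  deficient? E = anySubset? λ I → ∣ neighbours E I ∣ <? ∣ I ∣

  hall-≤ : ∀ {E} → Hall E → ∀ I → ∣ I ∣ ≤ ∣ neighbours E I ∣
  hall-≤ hall I = ≮⇒≥ λ def → hall (I , def)

  -- The singleton of `i` has at least one neighbour, and an edge of `E` witnessing it starts at
  -- `i`.
  hall⇒left-surjective : ∀ {E} → Hall E → ∀ i → ∃[ e ] (e ∈ E × left e ≡ i)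
  hall⇒left-surjective {E} hall i
    with ∈-neighbours⁻ {E} {⁅ i ⁆} (element∈ _ j)
    where
    j : Fin ∣ neighbours E ⁅ i ⁆ ∣
    j = inject≤ (zero {0})
          (≤-trans (≤-reflexive (sym (∣⁅x⁆∣≡1 i))) (hall-≤ hall ⁅ i ⁆))
  ... | e , e∈E , e∈⁅i⁆ , _ = e , e∈E , x∈⁅y⁆⇒x≡y i e∈⁅i⁆

  -- Were `left e` outside `I`, deleting `e` would not shrink the neighbourhood of `I`, and `I`
  -- would be deficient for `E` already.
  deficient-removal : ∀ {E e I} → Hall E → Deficient (E - e) I → left e ∈ I
  deficient-removal {E} {e} {I} hall def with left e ∈? I
  ... | yes e∈I = e∈I
  ... | no  e∉I = contradiction (hall-≤ hall I) (<⇒≱ (≤-trans (s≤s (p⊆q⇒∣p∣≤∣q∣ N⊆N′)) def))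
    where
    N⊆N′ : neighbours E I ⊆ neighbours (E - e) I
    N⊆N′ = neighbours⊆ λ f∈E f∈I →
      ∈-neighbours⁺ (x∈p∧x≢y⇒x∈p-y f∈E λ { refl → e∉I f∈I }) f∈I

  ¬both-deficient : ∀ {E e f} → Hall E → e ≢ f → left e ≡ left f →
                   ∀ {I J} → Deficient (E - e) I → ¬ Deficient (E - f) J
  ¬both-deficient {E} {e} {f} hall e≢f same {I} {J} defI defJ = <⇒≱ upper lower
    where
    e∈I = deficient-removal hall defI
    f∈J = deficient-removal hall defJ
    P = neighbours (E - e) I
    Q = neighbours (E - f) J

    ∪⊆ : neighbours E (I ∪ J) ⊆ P ∪ Q
    ∪⊆ = neighbours⊆ λ {g} g∈E g∈I∪J → x∈p∪q⁺ (place g g∈E (x∈p∪q⁻ I J g∈I∪J))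
      where
      place : ∀ g → g ∈ E → left g ∈ I ⊎ left g ∈ J → right g ∈ P ⊎ right g ∈ Q
      place g g∈E g∈I⊎J with g Fin.≟ e | g Fin.≟ f | g∈I⊎J
      -- The edge `e` survives in `E - f`, and its left end, shared with `f`, lies in `J`;
      -- symmetrically for `f` below.
      ... | yes refl | _        | _        =
        inj₂ (∈-neighbours⁺ (x∈p∧x≢y⇒x∈p-y g∈E e≢f) (subst (_∈ J) (sym same) f∈J))
      ... | no g≢e   | yes refl | _        =
        inj₁ (∈-neighbours⁺ (x∈p∧x≢y⇒x∈p-y g∈E g≢e) (subst (_∈ I) same e∈I))
      ... | no g≢e   | no g≢f   | inj₁ g∈I =
        inj₁ (∈-neighbours⁺ (x∈p∧x≢y⇒x∈p-y g∈E g≢e) g∈I)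
      ... | no g≢e   | no g≢f   | inj₂ g∈J =
        inj₂ (∈-neighbours⁺ (x∈p∧x≢y⇒x∈p-y g∈E g≢f) g∈J)

    -- Dropping the shared end excludes both `e` and `f`. It costs one node, whence the `suc` in
    -- `lower`; two strict deficiencies gain two in `upper`.
    ∩⊆ : neighbours E ((I ∩ J) - left e) ⊆ P ∩ Q
    ∩⊆ = neighbours⊆ λ {g} g∈E g∈ →
      let g∈I , g∈J = x∈p∩q⁻ I J (p─q⊆p _ _ g∈)
          g≢e : g ≢ e
          g≢e = λ { refl → x∉p-x (I ∩ J) (left e) g∈ }
          g≢f : g ≢ f
          g≢f = λ { refl → x∉p-x (I ∩ J) (left e)
                             (subst (_∈ (I ∩ J) - left e) (sym same) g∈) }
      in x∈p∩q⁺ ( ∈-neighbours⁺ (x∈p∧x≢y⇒x∈p-y g∈E g≢e) g∈I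
                , ∈-neighbours⁺ (x∈p∧x≢y⇒x∈p-y g∈E g≢f) g∈J)

    open ≤-Reasoning

    lower : ∣ I ∣ + ∣ J ∣ ≤ suc (∣ P ∣ + ∣ Q ∣)
    lower = begin
      ∣ I ∣ + ∣ J ∣                           ≡⟨ ∣p∪q∣+∣p∩q∣≡∣p∣+∣q∣ I J ⟨
      ∣ I ∪ J ∣ + ∣ I ∩ J ∣
        ≤⟨ +-mono-≤ (≤-trans (hall-≤ hall (I ∪ J)) (p⊆q⇒∣p∣≤∣q∣ ∪⊆))
             (≤-trans (∣p∣≤1+∣p-x∣ (I ∩ J) (left e))
               (s≤s (≤-trans (hall-≤ hall _) (p⊆q⇒∣p∣≤∣q∣ ∩⊆)))) ⟩
      ∣ P ∪ Q ∣ + suc ∣ P ∩ Q ∣               ≡⟨ +-suc ∣ P ∪ Q ∣ ∣ P ∩ Q ∣ ⟩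
      suc (∣ P ∪ Q ∣ + ∣ P ∩ Q ∣)             ≡⟨ cong suc (∣p∪q∣+∣p∩q∣≡∣p∣+∣q∣ P Q) ⟩
      suc (∣ P ∣ + ∣ Q ∣)                     ∎

    upper : suc (∣ P ∣ + ∣ Q ∣) < ∣ I ∣ + ∣ J ∣
    upper = begin
      suc (suc (∣ P ∣ + ∣ Q ∣))               ≡⟨ cong suc (+-suc ∣ P ∣ ∣ Q ∣) ⟨
      suc ∣ P ∣ + suc ∣ Q ∣                   ≤⟨ +-mono-≤ defI defJ ⟩
      ∣ I ∣ + ∣ J ∣                           ∎

  hall⇒saturating-matching : Hall ⊤ → ∃[ E ] (Hall E ×
    (∀ {e f} → e ∈ E → f ∈ E → left e ≡ left f → e ≡ f))
  hall⇒saturating-matching hall⊤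
    with minimumCardinality (λ E → ¬? (deficient? E)) (⊤ , hall⊤)
  ... | _ , (E , hall , refl) , minimal = E , hall , injective
    where
    shrink : ∀ {e} → e ∈ E → ¬ Hall (E - e)
    shrink e∈E hall′ = <⇒≱ (x∈p⇒∣p-x∣<∣p∣ e∈E) (minimal _ hall′)

    injective : ∀ {e f} → e ∈ E → f ∈ E → left e ≡ left f → e ≡ f
    -- By minimality neither deletion satisfies Hall's condition. This gives deficient sets only up
    -- to double negation, which decidable equality of edges makes sufficient.
    injective {e} {f} e∈E f∈E same = decidable-stable (e Fin.≟ f) λ e≢f →
      shrink e∈E λ (_ , defI) → shrink f∈E λ (_ , defJ) →
      ¬both-deficient hall e≢f same defI defJ

-- Perfect matchings in regular bipartite multigraphs.

-- The r-regular case: an edge is coordinatised by its left end and a number below r, and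
-- likewise by its right end.
module Regular .{{_ : NonZero r}} (φ ψ : Fin n ↔ (Fin m × Fin r)) where

  private
    module φ = Inverse φ
    module ψ = Inverse ψ

  left right : Fin n → Fin m
  left  = proj₁ ∘ φ.to
  right = proj₁ ∘ ψ.to

  open Bipartite left right

  -- Double counting: the `∣ I ∣ * r` edges leaving `I` all end in `N`, whose nodes receive
  -- `∣ N ∣ * r` edges in total; then `r` cancels.
  regular⇒hall : Hall ⊤
  regular⇒hall (I , def) =
    <⇒≱ def (*-cancelʳ-≤ ∣ I ∣ ∣ N ∣ r (injective⇒≤ {f = g ∘ remQuot r}
      (λ eq → remQuot-injective (g-injective eq))))
    where
    N = neighbours ⊤ I

    edge : Fin ∣ I ∣ × Fin r → Fin n
    edge (i , c) = φ.from (element I i , c)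

    right∈N : ∀ x → right (edge x) ∈ N
    right∈N (i , c) = ∈-neighbours⁺ ∈⊤
      (subst (_∈ I) (sym (cong proj₁ (φ.strictlyInverseˡ (element I i , c)))) (element∈ I i))

    -- An edge is encoded by its right coordinates under `ψ`, with the right end renumbered within
    -- `N`.
    g : Fin ∣ I ∣ × Fin r → Fin (∣ N ∣ * r)
    g x = combine (rank (right∈N x)) (proj₂ (ψ.to (edge x)))

    edge-injective : ∀ {x y} → edge x ≡ edge y → x ≡ y
    edge-injective eq with φ-eq ← Injection.injective (↔⇒↣ (↔-sym φ)) eq =
      cong₂ _,_ (element-injective I (,-injectiveˡ φ-eq)) (,-injectiveʳ φ-eq)

    g-injective : ∀ {x y} → g x ≡ g y → x ≡ y
    g-injective {x} {y} eq
      with rank-eq , c-eq ← combine-injective (rank (right∈N x)) _ (rank (right∈N y)) _ eq =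
      edge-injective (Injection.injective (↔⇒↣ ψ)
        (cong₂ _,_ (rank-injective (right∈N x) (right∈N y) rank-eq) c-eq))

    remQuot-injective : ∀ {i j : Fin (∣ I ∣ * r)} → remQuot {∣ I ∣} r i ≡ remQuot r j → i ≡ j
    remQuot-injective {i} {j} eq = trans (sym (combine-remQuot {∣ I ∣} r i))
      (trans (cong (λ (q , c) → combine q c) eq) (combine-remQuot {∣ I ∣} r j))

  perfect-matching : ∃[ E ] (∣ E ∣ ≤ m × (∀ i → ∃[ e ] (e ∈ E × left e ≡ i)) ×
                                         (∀ j → ∃[ e ] (e ∈ E × right e ≡ j)))
  perfect-matching with hall⇒saturating-matching regular⇒hall
  ... | E , hall , injective = E , ∣E∣≤m , hall⇒left-surjective hall , right-surjective
    where
    ∣E∣≤m : ∣ E ∣ ≤ m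
    ∣E∣≤m = injective⇒≤ {f = left ∘ element E}
      λ {i} {j} eq → element-injective E (injective (element∈ E i) (element∈ E j) eq)

    -- Both sides have `m` nodes, so Hall's condition for the entire left side leaves no right node
    -- uncovered.
    N≡⊤ : neighbours E ⊤ ≡ ⊤
    N≡⊤ = ∣p∣≡n⇒p≡⊤ (≤-antisym (∣p∣≤n (neighbours E ⊤))
      (≤-trans (≤-reflexive (sym (∣⊤∣≡n m))) (hall-≤ hall ⊤)))

    right-surjective : ∀ j → ∃[ e ] (e ∈ E × right e ≡ j)
    right-surjective j with ∈-neighbours⁻ {E} {⊤} (subst (j ∈_) (sym N≡⊤) ∈⊤)
    ... | e , e∈E , _ , eq = e , e∈E , eq

-- Dominating sets of a clique factor.

module CliqueFactor .{{_ : NonZero r}} {F : Graph (Fin n)} (F≅ : F ≅ m copiesOf K r) where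

  open _≅_ F≅

  clique : Fin n → Fin m
  clique = proj₁ ∘ to

  transversal⇒dominating : ∀ {S} → (∀ i → ∃[ u ] (u ∈ S × clique u ≡ i)) → Dominating F S
  transversal⇒dominating {S} hit v v∉S with hit (clique v)
  ... | u , u∈S , eq = u , u∈S , Equivalence.from (preserves v u) (sym eq , different)
    where
    different : proj₂ (to v) ≢ proj₂ (to u)
    -- Equal positions in one clique would identify `v` with `u`, which lies in `S`.
    different eq′ = v∉S (subst (_∈ S)
      (Injection.injective (↔⇒↣ bijection) (cong₂ _,_ eq (sym eq′))) u∈S)

  -- A sample vertex of clique `i` is in `S` or has a neighbour in `S`, and adjacency never leaves a
  -- clique.
  dominating⇒transversal : ∀ {S} → Dominating F S → ∀ i → ∃[ u ] (u ∈ S × clique u ≡ i)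
  dominating⇒transversal {S} dom i = hit (v ∈? S)
    where
    -- Position 0, available because `r` is nonzero.
    c : Fin r
    c = fromℕ< (n≢0⇒n>0 (≢-nonZero⁻¹ r))
    v = from (i , c)
    clique-v : clique v ≡ i
    clique-v = cong proj₁ (Inverse.strictlyInverseˡ bijection (i , c))
    hit : Dec (v ∈ S) → ∃[ u ] (u ∈ S × clique u ≡ i)
    hit (yes v∈S) = v , v∈S , clique-v
    hit (no  v∉S) with dom v v∉S
    ... | u , u∈S , vu = u , u∈S ,
      trans (sym (proj₁ (Equivalence.to (preserves v u) vu))) clique-v

  -- Representatives chosen in different cliques are different elements of `S`.
  dominating⇒≤ : ∀ {S} → Dominating F S → m ≤ ∣ S ∣
  dominating⇒≤ {S} dom = injective⇒≤ {f = λ i → rank (u∈S i)} λ {i} {j} eq →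
    trans (sym (clique-u i))
      (trans (cong clique (rank-injective (u∈S i) (u∈S j) eq)) (clique-u j))
    where
    hit      = dominating⇒transversal dom
    u∈S      = λ i → proj₁ (proj₂ (hit i))
    clique-u = λ i → proj₂ (proj₂ (hit i))

theorem15 : (r n : ℕ) .{{_ : NonZero r}} → r ≤ n → n % r ≡ 0 →
    (F₁ F₂ : Graph (Fin n)) →
    F₁ ≅ (n / r) copiesOf K r → F₂ ≅ (n / r) copiesOf K r →
    γsd F₁ F₂ ≡ n / r
theorem15 r n _ _ F₁ F₂ F₁≅ F₂≅ = ≤-antisym upper lower
  where
  module F₁ = CliqueFactor F₁≅
  module F₂ = CliqueFactor F₂≅

  upper : γsd F₁ F₂ ≤ n / r
  -- The two isomorphisms serve as left and right coordinates, so covering all nodes means meeting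
  -- every clique of both factors.
  upper with Regular.perfect-matching (_≅_.bijection F₁≅) (_≅_.bijection F₂≅)
  ... | E , ∣E∣≤ , hit₁ , hit₂ = ≤-trans
    (proj₂ (γsd-isMinimum F₁ F₂) E
      (F₁.transversal⇒dominating hit₁ , F₂.transversal⇒dominating hit₂))
    ∣E∣≤

  lower : n / r ≤ γsd F₁ F₂
  lower with γsd-isMinimum F₁ F₂
  ... | (S , (dom₁ , _) , ∣S∣≡γ) , _ = subst (n / r ≤_) ∣S∣≡γ (F₁.dominating⇒≤ dom₁)
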